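{- Let $n\ge 1$. Totally symmetric self-complementary plane partitions inside a $2n\times 2n\times 2n$ box are in bijection with tournaments on the vertex set $\{1,2,\dots,n\}$ satisfying the following condition on upsets: for all $1\le u<v\le n$, if vertex $v$ has $k$ upsets with vertices in $\{u,u+1,\dots,v-1\}$, then vertex $v-1$ has at most $k$ upsets with vertices in $\{u,u+1,\dots,v-2\}$.
   Context: A tournament on $\{1,\dots,n\}$ is a choice, for every pair $i<j$, of a winner of the game between $i$ and $j$. The game between $i<j$ is an upset if $j$ wins; "vertex $v$ has $k$ upsets with vertices in a set $W\subseteq\{1,\dots,v-1\}$" means $v$ beats exactly $k$ vertices of $W$. A plane partition inside a $2n\times 2n\times 2n$ box is an array $t=(t_{i,j})_{1\le i,j\le 2n}$ of integers in $\{0,\dots,2n\}$ weakly decreasing along rows and columns; it is totally symmetric if the set of cubes $\{(i,j,k):1\le k\le t_{i,j}\}$ is invariant under all permutations of the coordinates, and self-complementary if $t_{i,j}+t_{2n+1-i,2n+1-j}=2n$ for all $i,j$. -}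

module Defs where

open import Data.Nat using (ℕ; zero; suc; _+_; _*_; _∸_; _≤_; _<_; _≤?_; _<?_)
open import Data.Nat.Properties using (≤-trans)
open import Data.Bool using (Bool; true; false)
open import Data.List using (List; map; upTo)
open import Data.Nat.ListAction using (sum)
open import Data.Fin using (Fin)
open import Data.Fin.Permutation using (Permutation′; _⟨$⟩ʳ_)
open import Data.Product using (Σ; _×_; _,_; proj₁)
open import Function.Bundles using (_⇔_)
open import Relation.Nullary using (yes; no)
open import Relation.Binary.PropositionalEquality using (_≡_; refl; sym; trans)
open import Relation.Binary.Bundles using (Setoid)
open import Level using (0ℓ)

-- An array t = (t i j), indices 1 ≤ i, j ≤ 2n.  Values outside the box
-- are irrelevant (the equality below only looks inside the box).
Array : Set
Array = ℕ → ℕ → ℕ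

InBox : ℕ → ℕ → Set
InBox N i = (1 ≤ i) × (i ≤ N)

record IsPlanePartition (n : ℕ) (t : Array) : Set where
  field
    bounded  : ∀ i j → InBox (2 * n) i → InBox (2 * n) j → t i j ≤ 2 * n
    rowsDec  : ∀ i j j' → InBox (2 * n) i → InBox (2 * n) j → InBox (2 * n) j' →
               j ≤ j' → t i j' ≤ t i j
    colsDec  : ∀ i i' j → InBox (2 * n) i → InBox (2 * n) i' → InBox (2 * n) j →
               i ≤ i' → t i' j ≤ t i j

Point : Set
Point = Fin 3 → ℕ

i₀ j₀ k₀ : Fin 3
i₀ = Fin.zero
j₀ = Fin.suc Fin.zero
k₀ = Fin.suc (Fin.suc Fin.zero)

Cube : ℕ → Array → Point → Set
Cube n t c = InBox (2 * n) (c i₀) × InBox (2 * n) (c j₀) ×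
             (1 ≤ c k₀) × (c k₀ ≤ t (c i₀) (c j₀))

permute : Permutation′ 3 → Point → Point
permute σ c x = c (σ ⟨$⟩ʳ x)

TotallySymmetric : ℕ → Array → Set
TotallySymmetric n t = ∀ (σ : Permutation′ 3) (c : Point) → (Cube n t c ⇔ Cube n t (permute σ c))

SelfComplementary : ℕ → Array → Set
SelfComplementary n t = ∀ i j → InBox (2 * n) i → InBox (2 * n) j →
  t i j + t (2 * n + 1 ∸ i) (2 * n + 1 ∸ j) ≡ 2 * n

record IsTSSCPP (n : ℕ) (t : Array) : Set where
  field
    planePartition    : IsPlanePartition n t
    totallySymmetric  : TotallySymmetric n t
    selfComplementary : SelfComplementary n t

_≈PP_ : {n : ℕ} → Σ Array (IsTSSCPP n) → Σ Array (IsTSSCPP n) → Set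
_≈PP_ {n} (t , _) (t' , _) = ∀ i j → InBox (2 * n) i → InBox (2 * n) j → t i j ≡ t' i j

TSSCPPSetoid : ℕ → Setoid 0ℓ 0ℓ
TSSCPPSetoid n = record
  { Carrier = Σ Array (IsTSSCPP n)
  ; _≈_ = _≈PP_ {n}
  ; isEquivalence = record
    { refl = λ i j _ _ → refl
    ; sym = λ p i j a b → sym (p i j a b)
    ; trans = λ p q i j a b → trans (p i j a b) (q i j a b)
    }
  }

-- For every pair 1 ≤ i < j ≤ n: true iff j wins (the game is an upset).
Tournament : ℕ → Set
Tournament n = (i j : ℕ) → 1 ≤ i → i < j → j ≤ n → Bool

upset : {n : ℕ} → Tournament n → ℕ → ℕ → Bool
upset {n} T i j with 1 ≤? i | i <? j | j ≤? n
... | yes p | yes q | yes r = T i j p q r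
... | _     | _     | _     = false

b2n : Bool → ℕ
b2n true  = 1
b2n false = 0

range : ℕ → ℕ → List ℕ
range a b = map (a +_) (upTo (b ∸ a))

upsetsIn : {n : ℕ} → Tournament n → ℕ → ℕ → ℕ → ℕ
upsetsIn T v a b = sum (map (λ w → b2n (upset T w v)) (range a b))

UpsetCondition : (n : ℕ) → Tournament n → Set
UpsetCondition n T = ∀ u v → 1 ≤ u → u < v → v ≤ n → ∀ k →
  upsetsIn T v u v ≡ k → upsetsIn T (v ∸ 1) u (v ∸ 1) ≤ k

_≈T_ : {n : ℕ} → Σ (Tournament n) (UpsetCondition n) → Σ (Tournament n) (UpsetCondition n) → Set
_≈T_ {n} (T , _) (T' , _) = ∀ i j p q r → T i j p q r ≡ T' i j p q r

TournamentSetoid : ℕ → Setoid 0ℓ 0ℓ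
TournamentSetoid n = record
  { Carrier = Σ (Tournament n) (UpsetCondition n)
  ; _≈_ = _≈T_ {n}
  ; isEquivalence = record
    { refl = λ i j p q r → refl
    ; sym = λ e i j p q r → sym (e i j p q r)
    ; trans = λ e f i j p q r → trans (e i j p q r) (f i j p q r)
    }
  }

{-# OPTIONS --safe #-}

-- By symmetry and complementation a TSSCPP is determined by its cubes with
-- one coordinate ≤ n and two > n.  The slice at height n − a is a symmetric
-- partition; these slices grow with a, and compatibility with the other cubes
-- says exactly that the slice fits into an a × a square.  A symmetric
-- partition in an a × a square is a subset D of {1, …, a}: the lengths of its
-- rows from the diagonal rightwards.  Let D be the set of vertices beaten by
-- a + 1.  The number of elements ≥ u of D is the length of the (u − 1)-st
-- diagonal of the partition, so containment of consecutive slices is the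
-- condition on upsets.

module Submission where

open import Defs
open import Data.Bool using (Bool; true; false; not)
open import Data.Bool.Properties using (not-involutive; ¬-not; ⇔→≡)
open import Data.Empty using (⊥)
open import Data.Fin.Patterns using (0F; 1F; 2F)
open import Data.Fin.Permutation using (Permutation′; _⟨$⟩ʳ_; _⟨$⟩ˡ_; inverseˡ; transpose)
open import Data.List using (applyUpTo; map; _∷_)
open import Data.List.Properties using (map-applyUpTo; map-upTo; map-cong)
open import Data.Nat using (ℕ; zero; suc; _+_; _*_; _∸_; _⊓_; ∣_-_∣; _≤_; _<_; _≤?_; _<?_;
  z≤n; s≤s; s≤s⁻¹; s<s⁻¹)
open import Data.Nat.ListAction using (sum)
open import Data.Nat.Properties
open import Data.Product using (Σ; ∃; _×_; _,_; proj₁; proj₂)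
open import Data.Sum using (inj₁; inj₂)
open import Function.Base using (_∘_; id)
open import Function.Bundles using (Bijection; _⇔_; mk⇔; module Equivalence)
open import Relation.Binary.PropositionalEquality
open import Relation.Nullary using (Dec; yes; no; does; contradiction)
open import Relation.Nullary.Decidable using (dec-true; dec-false)

open Equivalence using (to; from)

-- Booleans, initial runs and permutations of three coordinates

does⁻ : ∀ {A : Set} (a? : Dec A) → does a? ≡ true → A
does⁻ (yes a) _ = a

true-antisym : ∀ {x y} → (x ≡ true → y ≡ true) → (y ≡ true → x ≡ true) → x ≡ y
true-antisym f g = ⇔→≡ (mk⇔ f g)

not-anti : ∀ {x y} → (x ≡ true → y ≡ true) → not y ≡ true → not x ≡ true
not-anti {false}         f _ = refl
not-anti {true}  {false} f _ = f refl
not-anti {true}  {true}  f ()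

-- Lets column heights and diagonal lengths be compared one cube or cell at a time.
≤-from-< : ∀ {x y} → (∀ k → k < x → k < y) → x ≤ y
≤-from-< {zero}  f = z≤n
≤-from-< {suc x} f = f x ≤-refl

initialRun : (ℕ → Bool) → ℕ → ℕ
initialRun f zero = 0
initialRun f (suc m) with f 0
... | true  = suc (initialRun (f ∘ suc) m)
... | false = 0

initialRun-≤ : ∀ f m → initialRun f m ≤ m
initialRun-≤ f zero = z≤n
initialRun-≤ f (suc m) with f 0
... | true  = s≤s (initialRun-≤ (f ∘ suc) m)
... | false = z≤n

<-initialRun⁻ : ∀ f m {k} → k < initialRun f m → f k ≡ true
<-initialRun⁻ f (suc m) {k} k< with f 0 in eq
<-initialRun⁻ f (suc m) {zero}  k< | true = eq
<-initialRun⁻ f (suc m) {suc k} k< | true = <-initialRun⁻ (f ∘ suc) m (s<s⁻¹ k<)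

-- If `f 0` failed, `down` would carry the truth of `f k` down to `f 0`; so the run of a downward
-- closed predicate misses no argument below `m` at which it holds.
<-initialRun⁺ : ∀ f m → (∀ j → suc j < m → f (suc j) ≡ true → f j ≡ true) →
                ∀ {k} → k < m → f k ≡ true → k < initialRun f m
<-initialRun⁺ f (suc m) down {k} k<m fk with f 0 in eq
<-initialRun⁺ f (suc m) down {zero}  k<m fk | true = s≤s z≤n
<-initialRun⁺ f (suc m) down {suc k} k<m fk | true =
  s≤s (<-initialRun⁺ (f ∘ suc) m (λ j j< → down (suc j) (s≤s j<)) (s<s⁻¹ k<m) fk)
<-initialRun⁺ f (suc m) down {zero}  k<m fk | false =
  contradiction (trans (sym eq) fk) λ ()
<-initialRun⁺ f (suc m) down {suc k} k<m fk | false =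
  contradiction (trans (sym eq) (descend k k<m fk)) λ ()
  where
  descend : ∀ k → suc k < suc m → f (suc k) ≡ true → f 0 ≡ true
  descend zero    lt e = down 0 lt e
  descend (suc k) lt e = descend k (<-trans (n<1+n _) lt) (down (suc k) lt e)

-- The two adjacent transpositions generate the symmetric group: each of the six permutations is a
-- word in them, and triples of indices with a repetition are excluded by injectivity.
permutation-invariant : (S : ℕ → ℕ → ℕ → Set) →
  (∀ {i j k} → S i j k → S j i k) → (∀ {i j k} → S i j k → S i k j) →
  (σ : Permutation′ 3) (c : Point) →
  S (c i₀) (c j₀) (c k₀) ⇔ S (c (σ ⟨$⟩ʳ i₀)) (c (σ ⟨$⟩ʳ j₀)) (c (σ ⟨$⟩ʳ k₀))
permutation-invariant S s t σ c = cases _ _ _ (distinct λ ()) (distinct λ ()) (distinct λ ())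
  where
  distinct : ∀ {x y} → x ≢ y → σ ⟨$⟩ʳ x ≢ σ ⟨$⟩ʳ y
  distinct x≢y e = x≢y (trans (sym (inverseˡ σ)) (trans (cong (σ ⟨$⟩ˡ_) e) (inverseˡ σ)))
  cases : ∀ x y z → x ≢ y → y ≢ z → x ≢ z → S (c i₀) (c j₀) (c k₀) ⇔ S (c x) (c y) (c z)
  cases 0F 1F 2F _ _ _ = mk⇔ id id
  cases 0F 2F 1F _ _ _ = mk⇔ t t
  cases 1F 0F 2F _ _ _ = mk⇔ s s
  cases 1F 2F 0F _ _ _ = mk⇔ (t ∘ s) (s ∘ t)
  cases 2F 0F 1F _ _ _ = mk⇔ (s ∘ t) (t ∘ s)
  cases 2F 1F 0F _ _ _ = mk⇔ (s ∘ t ∘ s) (s ∘ t ∘ s)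
  cases 0F 0F _  p _ _ = contradiction refl p
  cases 1F 1F _  p _ _ = contradiction refl p
  cases 2F 2F _  p _ _ = contradiction refl p
  cases 0F 1F 0F _ _ r = contradiction refl r
  cases 0F 1F 1F _ q _ = contradiction refl q
  cases 0F 2F 0F _ _ r = contradiction refl r
  cases 0F 2F 2F _ q _ = contradiction refl q
  cases 1F 0F 0F _ q _ = contradiction refl q
  cases 1F 0F 1F _ _ r = contradiction refl r
  cases 1F 2F 1F _ _ r = contradiction refl r
  cases 1F 2F 2F _ q _ = contradiction refl q
  cases 2F 0F 0F _ q _ = contradiction refl q
  cases 2F 0F 2F _ _ r = contradiction refl r
  cases 2F 1F 1F _ q _ = contradiction refl q
  cases 2F 1F 2F _ _ r = contradiction refl r

-- Truncated subtraction, 0-1 differences and sums over ranges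

<∸⇒+< : ∀ r a d → r < a ∸ d → r + d < a
<∸⇒+< r a       zero    r< = subst (_< a) (sym (+-identityʳ r)) r<
<∸⇒+< r (suc a) (suc d) r< = subst (_< suc a) (sym (+-suc r d)) (s≤s (<∸⇒+< r a d r<))

does-<?-b2n : ∀ y b → does (y <? b2n b + y) ≡ b
does-<?-b2n y true  = dec-true (y <? suc y) ≤-refl
does-<?-b2n y false = dec-false (y <? y) (<-irrefl refl)

-- The difference of `x` and `y` is 0 or 1, so the test `y <? x` is that difference.
b2n-<?-+ : ∀ {x y} → y ≤ x → x ≤ suc y → b2n (does (y <? x)) + y ≡ x
b2n-<?-+ {x} {y} y≤x x≤1+y with does (y <? x) in eq
... | true  = ≤-antisym (does⁻ (y <? x) eq) x≤1+y
... | false = ≤-antisym y≤x (≮⇒≥ λ y<x → contradiction (trans (sym eq) (dec-true (y <? x) y<x)) λ ())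

b2n≤1 : ∀ b → b2n b ≤ 1
b2n≤1 true  = ≤-refl
b2n≤1 false = z≤n

applyUpTo-cong : ∀ {f g : ℕ → ℕ} → (∀ k → f k ≡ g k) → ∀ m → applyUpTo f m ≡ applyUpTo g m
applyUpTo-cong eq zero    = refl
applyUpTo-cong eq (suc m) = cong₂ _∷_ (eq 0) (applyUpTo-cong (eq ∘ suc) m)

sum-range : ∀ (f : ℕ → ℕ) a b → sum (map f (range a b)) ≡ sum (applyUpTo (f ∘ (a +_)) (b ∸ a))
sum-range f a b = cong sum (trans (cong (map f) (map-upTo (a +_) (b ∸ a))) (map-applyUpTo (a +_) f (b ∸ a)))

sum-range-empty : ∀ (f : ℕ → ℕ) {a b} → b ≤ a → sum (map f (range a b)) ≡ 0
sum-range-empty f {a} {b} b≤a rewrite m≤n⇒m∸n≡0 b≤a = refl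

sum-range-step : ∀ (f : ℕ → ℕ) {a b} → a < b →
                 sum (map f (range a b)) ≡ f a + sum (map f (range (suc a) b))
sum-range-step f {a} {b} a<b = begin
  sum (map f (range a b))
    ≡⟨ sum-range f a b ⟩
  sum (applyUpTo (f ∘ (a +_)) (b ∸ a))
    ≡⟨ cong (sum ∘ applyUpTo _) (∸-suc a<b) ⟩
  f (a + 0) + sum (applyUpTo (f ∘ (a +_) ∘ suc) (b ∸ suc a))
    ≡⟨ cong₂ (λ x l → f x + sum l) (+-identityʳ a) (applyUpTo-cong (cong f ∘ +-suc a) (b ∸ suc a)) ⟩
  f a + sum (applyUpTo (f ∘ (suc a +_)) (b ∸ suc a))
    ≡⟨ cong (f a +_) (sum-range f (suc a) b) ⟨
  f a + sum (map f (range (suc a) b))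
    ∎
  where
  open ≡-Reasoning
  ∸-suc : ∀ {a b} → a < b → b ∸ a ≡ suc (b ∸ suc a)
  ∸-suc {zero}  {suc b} _         = refl
  ∸-suc {suc a} {suc b} (s≤s a<b) = ∸-suc a<b

-- Coordinates measured from the centre of the box

-- Inside the box, low a is the index n − a and high b is n + 1 + b, for a, b < n.
data Coord : Set where
  low high : ℕ → Coord

size : Coord → ℕ
size (low a)  = a
size (high b) = b

flip : Coord → Coord
flip (low a)  = high a
flip (high b) = low b

-- The order of the indices. It reverses the sizes of `low` coordinates because `low a` is the index
-- `n - a`.
data _⊑_ : Coord → Coord → Set where
  low-low   : ∀ {a b} → b ≤ a → low a ⊑ low b
  low-high  : ∀ {a b} → low a ⊑ high b
  high-high : ∀ {a b} → a ≤ b → high a ⊑ high b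

⊑-refl : ∀ {x} → x ⊑ x
⊑-refl {low a}  = low-low ≤-refl
⊑-refl {high b} = high-high ≤-refl

size-flip : ∀ x → size (flip x) ≡ size x
size-flip (low a)  = refl
size-flip (high b) = refl

module _ (n : ℕ) where

  -- Order ideals of cubes and their kernels

  Valid : Coord → Set
  Valid x = size x < n

  -- The cubes of a totally symmetric self-complementary plane partition.
  record IsIdeal (P : Coord → Coord → Coord → Bool) : Set where
    field
      swap₁₂ : ∀ x y z → Valid x → Valid y → Valid z → P x y z ≡ P y x z
      swap₂₃ : ∀ x y z → Valid x → Valid y → Valid z → P x y z ≡ P x z y
      down₃  : ∀ x y z z' → Valid x → Valid y → Valid z → Valid z' →
               z ⊑ z' → P x y z' ≡ true → P x y z ≡ true
      compl  : ∀ x y z → Valid x → Valid y → Valid z →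
               P (flip x) (flip y) (flip z) ≡ not (P x y z)

    down₂ : ∀ x y y' z → Valid x → Valid y → Valid y' → Valid z →
            y ⊑ y' → P x y' z ≡ true → P x y z ≡ true
    down₂ x y y' z vx vy vy' vz le p =
      trans (swap₂₃ x y z vx vy vz)
        (down₃ x z y y' vx vz vy vy' le (trans (swap₂₃ x z y' vx vz vy') p))

    down₁ : ∀ x x' y z → Valid x → Valid x' → Valid y → Valid z →
            x ⊑ x' → P x' y z ≡ true → P x y z ≡ true
    down₁ x x' y z vx vx' vy vz le p =
      trans (swap₁₂ x y z vx vy vz)
        (down₂ y x x' z vy vx vx' vz le (trans (swap₁₂ y x' z vy vx' vz) p))

  -- `Q a` is the part of the slice at `n - a` with two high coordinates, cells being numbered from
  -- 0: a symmetric partition (`symm`, `anti`) that grows with `a` (`mono`) and fits into an `a` by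
  -- `a` square (`bound`).
  record IsKernel (Q : ℕ → ℕ → ℕ → Bool) : Set where
    field
      symm  : ∀ a b c → a < n → b < n → c < n → Q a b c ≡ Q a c b
      anti  : ∀ a b c c' → a < n → b < n → c' < n → c ≤ c' → Q a b c' ≡ true → Q a b c ≡ true
      mono  : ∀ a a' b c → a' < n → b < n → c < n → a ≤ a' → Q a b c ≡ true → Q a' b c ≡ true
      bound : ∀ a b c → a < n → b < n → c < n → Q a b c ≡ true → c < a

  kernel : (Coord → Coord → Coord → Bool) → ℕ → ℕ → ℕ → Bool
  kernel P a b c = P (low a) (high b) (high c)

  -- Complementation exchanges cubes with one and with two high coordinates, hence the negations.
  -- The two constant cases are forced, as `not-high` shows.
  ideal : (ℕ → ℕ → ℕ → Bool) → Coord → Coord → Coord → Bool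
  ideal Q (low a)  (low b)  (low c)  = true
  ideal Q (high a) (low b)  (low c)  = not (Q a b c)
  ideal Q (low b)  (high a) (low c)  = not (Q a b c)
  ideal Q (low b)  (low c)  (high a) = not (Q a b c)
  ideal Q (low a)  (high b) (high c) = Q a b c
  ideal Q (high b) (low a)  (high c) = Q a b c
  ideal Q (high b) (high c) (low a)  = Q a b c
  ideal Q (high a) (high b) (high c) = false

  ideal-isIdeal : ∀ {Q} → IsKernel Q → IsIdeal (ideal Q)
  ideal-isIdeal {Q} K = record { swap₁₂ = swap₁₂ ; swap₂₃ = swap₂₃ ; down₃ = down₃ ; compl = compl }
    where
    open IsKernel K
    swap₁₂ : ∀ x y z → Valid x → Valid y → Valid z → ideal Q x y z ≡ ideal Q y x z
    swap₁₂ (low a)  (low b)  (low c)  va vb vc = refl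
    swap₁₂ (low a)  (low b)  (high c) va vb vc = cong not (symm c a b vc va vb)
    swap₁₂ (low a)  (high b) (low c)  va vb vc = refl
    swap₁₂ (low a)  (high b) (high c) va vb vc = refl
    swap₁₂ (high a) (low b)  (low c)  va vb vc = refl
    swap₁₂ (high a) (low b)  (high c) va vb vc = refl
    swap₁₂ (high a) (high b) (low c)  va vb vc = symm c a b vc va vb
    swap₁₂ (high a) (high b) (high c) va vb vc = refl

    swap₂₃ : ∀ x y z → Valid x → Valid y → Valid z → ideal Q x y z ≡ ideal Q x z y
    swap₂₃ (low a)  (low b)  (low c)  va vb vc = refl
    swap₂₃ (low a)  (low b)  (high c) va vb vc = refl
    swap₂₃ (low a)  (high b) (low c)  va vb vc = refl
    swap₂₃ (low a)  (high b) (high c) va vb vc = symm a b c va vb vc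
    swap₂₃ (high a) (low b)  (low c)  va vb vc = cong not (symm a b c va vb vc)
    swap₂₃ (high a) (low b)  (high c) va vb vc = refl
    swap₂₃ (high a) (high b) (low c)  va vb vc = refl
    swap₂₃ (high a) (high b) (high c) va vb vc = refl

    -- Q a b c' forces b < a while Q b a c forces a < b.
    cross : ∀ a b c c' → a < n → b < n → c < n → c' < n → Q a b c' ≡ true → not (Q b a c) ≡ true
    cross a b c c' va vb vc vc' q = sym (¬-not λ { e →
      <-asym (bound a c' b va vc' vb (trans (symm a c' b va vc' vb) q))
             (bound b c a vb vc va (trans (symm b c a vb vc va) (sym e))) })

    down₃ : ∀ x y z z' → Valid x → Valid y → Valid z → Valid z' →
            z ⊑ z' → ideal Q x y z' ≡ true → ideal Q x y z ≡ true
    down₃ (low a)  (low b)  _ _ va vb vc vc' (low-low le)   p = refl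
    down₃ (low a)  (low b)  _ _ va vb vc vc' low-high       p = refl
    down₃ (low a)  (low b)  _ _ va vb vc vc' (high-high le) p = not-anti (mono _ _ a b vc' va vb le) p
    down₃ (low a)  (high b) _ _ va vb vc vc' (low-low le)   p = not-anti (anti b a _ _ vb va vc le) p
    -- Here the number of high coordinates drops from two to one, so membership changes from `Q` to
    -- a negated `Q`; the bound of the kernel bridges the two.
    down₃ (low a)  (high b) _ _ va vb vc vc' low-high       p = cross a b _ _ va vb vc vc' p
    down₃ (low a)  (high b) _ _ va vb vc vc' (high-high le) p = anti a b _ _ va vb vc' le p
    down₃ (high a) (low b)  _ _ va vb vc vc' (low-low le)   p = not-anti (anti a b _ _ va vb vc le) p
    down₃ (high a) (low b)  _ _ va vb vc vc' low-high       p = cross b a _ _ vb va vc vc' p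
    down₃ (high a) (low b)  _ _ va vb vc vc' (high-high le) p = anti b a _ _ vb va vc' le p
    down₃ (high a) (high b) _ _ va vb vc vc' (low-low le)   p = mono _ _ a b vc va vb le p

    compl : ∀ x y z → Valid x → Valid y → Valid z →
            ideal Q (flip x) (flip y) (flip z) ≡ not (ideal Q x y z)
    compl (low a)  (low b)  (low c)  va vb vc = refl
    compl (low a)  (low b)  (high c) va vb vc = sym (not-involutive _)
    compl (low a)  (high b) (low c)  va vb vc = sym (not-involutive _)
    compl (low a)  (high b) (high c) va vb vc = refl
    compl (high a) (low b)  (low c)  va vb vc = sym (not-involutive _)
    compl (high a) (low b)  (high c) va vb vc = refl
    compl (high a) (high b) (low c)  va vb vc = refl
    compl (high a) (high b) (high c) va vb vc = refl

  -- An ideal is determined by its kernel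

  module _ {P} (I : IsIdeal P) where
    open IsIdeal I

    kernel-isKernel : IsKernel (kernel P)
    kernel-isKernel = record
      { symm  = λ a b c va vb vc → swap₂₃ (low a) (high b) (high c) va vb vc
      ; anti  = λ a b c c' va vb vc' le p →
          down₃ (low a) (high b) (high c) (high c') va vb (≤-<-trans le vc') vc' (high-high le) p
      ; mono  = λ a a' b c va' vb vc le p →
          down₁ (low a') (low a) (high b) (high c) va' (≤-<-trans le va') vb vc (low-low le) p
      ; bound = λ a b c va vb vc p → ≰⇒> λ a≤c → bound a b c va vb vc a≤c p
      }
      where
      -- The cubes (low a, low b, high a) and (low a, high b, high a) lie below
      -- (low a, high b, high c), but are complements up to symmetry.
      bound : ∀ a b c → a < n → b < n → c < n → a ≤ c → P (low a) (high b) (high c) ≡ true → ⊥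
      bound a b c va vb vc a≤c p = contradiction
        (trans (sym q) (trans (compl (high a) (low b) (low a) va vb va) (cong not r))) λ ()
        where
        q : P (low a) (high b) (high a) ≡ true
        q = down₃ (low a) (high b) (high a) (high c) va vb va vc (high-high a≤c) p
        r : P (high a) (low b) (low a) ≡ true
        r = trans (swap₁₂ (high a) (low b) (low a) va vb va)
              (trans (swap₂₃ (low b) (high a) (low a) vb va va)
                (trans (swap₁₂ (low b) (low a) (high a) vb va va)
                  (down₂ (low a) (low b) (high b) (high a) va vb vb va low-high q)))

    -- Such a cube lies above its own complement, and exactly one of the two is present.
    not-high : ∀ a b c → a < n → b < n → c < n → P (high a) (high b) (high c) ≡ false
    not-high a b c va vb vc = ¬-not λ p → contradiction
      (trans (sym p) (trans (compl (low a) (low b) (low c) va vb vc) (cong not (lows p)))) λ ()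
      where
      lows : P (high a) (high b) (high c) ≡ true → P (low a) (low b) (low c) ≡ true
      lows p = down₁ (low a) (high a) (low b) (low c) va va vb vc low-high
                (down₂ (high a) (low b) (high b) (low c) va vb vb vc low-high
                  (down₃ (high a) (high b) (low c) (high c) va vb vc vc low-high p))

    -- Symmetry moves the coordinate that differs in kind from the other two to the front, and
    -- complementation turns one high coordinate into two.
    ideal-kernel : ∀ x y z → Valid x → Valid y → Valid z → P x y z ≡ ideal (kernel P) x y z
    ideal-kernel (low a)  (low b)  (low c)  va vb vc =
      trans (compl (high a) (high b) (high c) va vb vc) (cong not (not-high a b c va vb vc))
    ideal-kernel (high a) (low b)  (low c)  va vb vc = compl (low a) (high b) (high c) va vb vc
    ideal-kernel (low b)  (high a) (low c)  vb va vc =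
      trans (swap₁₂ (low b) (high a) (low c) vb va vc) (compl (low a) (high b) (high c) va vb vc)
    ideal-kernel (low b)  (low c)  (high a) vb vc va =
      trans (swap₂₃ (low b) (low c) (high a) vb vc va)
        (trans (swap₁₂ (low b) (high a) (low c) vb va vc) (compl (low a) (high b) (high c) va vb vc))
    ideal-kernel (low a)  (high b) (high c) va vb vc = refl
    ideal-kernel (high b) (low a)  (high c) vb va vc = swap₁₂ (high b) (low a) (high c) vb va vc
    ideal-kernel (high b) (high c) (low a)  vb vc va =
      trans (swap₂₃ (high b) (high c) (low a) vb vc va) (swap₁₂ (high b) (low a) (high c) vb va vc)
    ideal-kernel (high a) (high b) (high c) va vb vc = not-high a b c va vb vc

  -- Translation between coordinates and indices of the box

  index : Coord → ℕ
  index (low a)  = n ∸ a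
  index (high b) = suc n + b

  coord : ℕ → Coord
  coord i with i ≤? n
  ... | yes _ = low (n ∸ i)
  ... | no  _ = high (i ∸ suc n)

  2*n≡n+n : 2 * n ≡ n + n
  2*n≡n+n = cong (n +_) (+-identityʳ n)

  2*n+1≡suc[n+n] : 2 * n + 1 ≡ suc (n + n)
  2*n+1≡suc[n+n] = trans (+-comm (2 * n) 1) (cong suc 2*n≡n+n)

  index-inBox : ∀ x → Valid x → InBox (2 * n) (index x)
  index-inBox (low a)  v = m<n⇒0<n∸m v , ≤-trans (m∸n≤m n a) (m≤m+n n _)
  index-inBox (high b) v = s≤s z≤n , subst (suc n + b ≤_) (sym 2*n≡n+n)
    (subst (_≤ n + n) (+-suc n b) (+-monoʳ-≤ n v))

  coord-index : ∀ x → Valid x → coord (index x) ≡ x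
  coord-index (low a) v with n ∸ a ≤? n
  ... | yes _ = cong low (m∸[m∸n]≡n (<⇒≤ v))
  ... | no ¬p = contradiction (m∸n≤m n a) ¬p
  coord-index (high b) v with suc n + b ≤? n
  ... | yes p = contradiction (≤-trans (m≤m+n (suc n) b) p) 1+n≰n
  ... | no _  = cong high (m+n∸m≡n n b)

  index-coord : ∀ {i} → InBox (2 * n) i → ∃ λ x → Valid x × index x ≡ i
  index-coord {i} (1≤i , i≤2n) with i ≤? n
  ... | yes i≤n = low (n ∸ i) , ∸-monoʳ-< 1≤i i≤n , m∸[m∸n]≡n i≤n
  ... | no  i≰n = high (i ∸ suc n) , +-cancelˡ-< (suc n) _ _ lt , m+[n∸m]≡n (≰⇒> i≰n)
    where
    lt : suc n + (i ∸ suc n) < suc n + n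
    lt = subst₂ _<_ (sym (m+[n∸m]≡n (≰⇒> i≰n))) (cong suc 2*n≡n+n) (s≤s i≤2n)

  index-flip : ∀ x → Valid x → 2 * n + 1 ∸ index x ≡ index (flip x)
  index-flip (low a) v = begin
    2 * n + 1 ∸ (n ∸ a)                   ≡⟨ cong (_∸ (n ∸ a)) 2*n+1≡suc[n+n] ⟩
    suc n + n ∸ (n ∸ a)                   ≡⟨ +-∸-assoc (suc n) (m∸n≤m n a) ⟩
    suc n + (n ∸ (n ∸ a))                 ≡⟨ cong (suc n +_) (m∸[m∸n]≡n (<⇒≤ v)) ⟩
    suc n + a                             ∎
    where open ≡-Reasoning
  index-flip (high b) v = trans (cong (_∸ (suc n + b)) 2*n+1≡suc[n+n]) ([m+n]∸[m+o]≡n∸o n n b)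

  index-sum : ∀ z → Valid z → index z + index (flip z) ≡ suc (2 * n)
  index-sum z vz = trans (cong (index z +_) (sym (index-flip z vz)))
    (trans (m+[n∸m]≡n (≤-trans (proj₂ (index-inBox z vz)) (m≤m+n (2 * n) 1))) (+-comm (2 * n) 1))

  index-mono : ∀ {x y} → x ⊑ y → index x ≤ index y
  index-mono (low-low le)       = ∸-monoʳ-≤ n le
  index-mono {low a} {high b} low-high = ≤-trans (m∸n≤m n a) (≤-trans (n≤1+n n) (m≤m+n (suc n) b))
  index-mono (high-high le)     = +-monoʳ-≤ (suc n) le

  index-cancel-≤ : ∀ x y → Valid x → Valid y → index x ≤ index y → x ⊑ y
  index-cancel-≤ (low a)  (low b)  vx vy le = low-low (∸-cancelʳ-≤ (<⇒≤ vy) le)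
  index-cancel-≤ (low a)  (high b) vx vy le = low-high
  index-cancel-≤ (high a) (low b)  vx vy le =
    contradiction (≤-trans (m≤m+n (suc n) a) (≤-trans le (m∸n≤m n b))) 1+n≰n
  index-cancel-≤ (high a) (high b) vx vy le = high-high (+-cancelˡ-≤ (suc n) _ _ le)

  flip-valid : ∀ x → Valid x → Valid (flip x)
  flip-valid x = subst (_< n) (sym (size-flip x))

  -- The ideal of a plane partition

  cubes : Array → Coord → Coord → Coord → Bool
  cubes t x y z = does (index z ≤? t (index x) (index y))

  cubes⁻ : ∀ t x y z → cubes t x y z ≡ true → index z ≤ t (index x) (index y)
  cubes⁻ t x y z = does⁻ (index z ≤? t (index x) (index y))

  cubes⁺ : ∀ t x y z → index z ≤ t (index x) (index y) → cubes t x y z ≡ true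
  cubes⁺ t x y z = dec-true (index z ≤? t (index x) (index y))

  point : ℕ → ℕ → ℕ → Point
  point i j k 0F = i
  point i j k 1F = j
  point i j k 2F = k

  module _ {t} (tsscpp : IsTSSCPP n t) where
    open IsTSSCPP tsscpp
    open IsPlanePartition planePartition

    cubes-isIdeal : IsIdeal (cubes t)
    cubes-isIdeal = record
      { swap₁₂ = λ x y z vx vy vz → true-antisym (swap₁₂ x y z vx vy vz) (swap₁₂ y x z vy vx vz)
      ; swap₂₃ = λ x y z vx vy vz → true-antisym (swap₂₃ x y z vx vy vz) (swap₂₃ x z y vx vz vy)
      ; down₃  = λ x y z z' vx vy vz vz' le p →
          cubes⁺ t x y z (≤-trans (index-mono le) (cubes⁻ t x y z' p))
      ; compl  = λ x y z vx vy vz → compl x y z vx vy vz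
      }
      where
      swap₁₂ : ∀ x y z → Valid x → Valid y → Valid z → cubes t x y z ≡ true → cubes t y x z ≡ true
      swap₁₂ x y z vx vy vz p = cubes⁺ t y x z (proj₂ (proj₂ (proj₂
        (to (totallySymmetric (transpose i₀ j₀) (point (index x) (index y) (index z)))
          (index-inBox x vx , index-inBox y vy , proj₁ (index-inBox z vz) , cubes⁻ t x y z p)))))

      swap₂₃ : ∀ x y z → Valid x → Valid y → Valid z → cubes t x y z ≡ true → cubes t x z y ≡ true
      swap₂₃ x y z vx vy vz p = cubes⁺ t x z y (proj₂ (proj₂ (proj₂
        (to (totallySymmetric (transpose j₀ k₀) (point (index x) (index y) (index z)))
          (index-inBox x vx , index-inBox y vy , proj₁ (index-inBox z vz) , cubes⁻ t x y z p)))))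

      sum≡2n : ∀ x y → Valid x → Valid y →
               t (index x) (index y) + t (index (flip x)) (index (flip y)) ≡ 2 * n
      sum≡2n x y vx vy = subst₂ (λ i j → t (index x) (index y) + t i j ≡ 2 * n)
        (index-flip x vx) (index-flip y vy)
        (selfComplementary (index x) (index y) (index-inBox x vx) (index-inBox y vy))

      -- Complementary heights add up to `2 * n` but complementary indices to `2 * n + 1`, so
      -- exactly one of two complementary cubes fits under its height.
      compl : ∀ x y z → Valid x → Valid y → Valid z →
              cubes t (flip x) (flip y) (flip z) ≡ not (cubes t x y z)
      compl x y z vx vy vz with cubes t x y z in eq
      ... | true  = ¬-not λ e → 1+n≰n (subst₂ _≤_ (index-sum z vz) (sum≡2n x y vx vy)
                      (+-mono-≤ (cubes⁻ t x y z eq) (cubes⁻ t (flip x) (flip y) (flip z) e)))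
      ... | false = cubes⁺ t (flip x) (flip y) (flip z)
                      (+-cancelˡ-≤ t-xy _ _ (subst (t-xy + index (flip z) ≤_)
                        (sym (sum≡2n x y vx vy)) (s≤s⁻¹ (subst (t-xy + index (flip z) <_)
                          (index-sum z vz) (+-monoˡ-< _ (≰⇒> λ p →
                            contradiction (trans (sym eq) (cubes⁺ t x y z p)) λ ()))))))
        where t-xy = t (index x) (index y)

  -- Heights are at most `2 * n`, so every level of a column is the index of a valid coordinate and
  -- is seen by `cubes`.
  cubes-injective : ∀ {t t'} → IsTSSCPP n t → IsTSSCPP n t' →
    (∀ x y z → Valid x → Valid y → Valid z → cubes t x y z ≡ cubes t' x y z) →
    ∀ i j → InBox (2 * n) i → InBox (2 * n) j → t i j ≡ t' i j
  cubes-injective T T' eq i j bi bj =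
    ≤-antisym (half T eq) (half T' (λ x y z vx vy vz → sym (eq x y z vx vy vz)))
    where
    half : ∀ {t t'} → IsTSSCPP n t →
      (∀ x y z → Valid x → Valid y → Valid z → cubes t x y z ≡ cubes t' x y z) → t i j ≤ t' i j
    half {t} {t'} T eq with index-coord bi | index-coord bj
    ... | x , vx , refl | y , vy , refl = ≤-from-< λ k k< →
      let bound = IsPlanePartition.bounded (IsTSSCPP.planePartition T) _ _ bi bj
          (z , vz , ez) = index-coord {suc k} (s≤s z≤n , ≤-trans k< bound)
      in subst (_≤ _) ez (cubes⁻ t' x y z (trans (sym (eq x y z vx vy vz))
           (cubes⁺ t x y z (subst (_≤ _) (sym ez) k<))))

  -- The plane partition of an ideal

  array : (Coord → Coord → Coord → Bool) → Array
  array P i j = initialRun (λ k → P (coord i) (coord j) (coord (suc k))) (2 * n)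

  module _ {P} (I : IsIdeal P) where
    open IsIdeal I

    P-coord : ∀ {i j k} x y z → Valid x → Valid y → Valid z → index x ≡ i → index y ≡ j → index z ≡ k →
              P (coord i) (coord j) (coord k) ≡ P x y z
    P-coord x y z vx vy vz refl refl refl
      rewrite coord-index x vx | coord-index y vy | coord-index z vz = refl

    -- The ideal is closed downwards in the third coordinate, so the initial run over a column is
    -- the whole column. Levels start at 1 and positions in the run at 0.
    ≤-array : ∀ x y z → Valid x → Valid y → Valid z →
              index z ≤ array P (index x) (index y) ⇔ P x y z ≡ true
    ≤-array x y z vx vy vz with index z in ez | index-inBox z vz
    ... | suc k | _ , k<2n = mk⇔
      (λ le → trans (sym P≡) (<-initialRun⁻ _ (2 * n) le))
      (λ p → <-initialRun⁺ _ (2 * n) decreasing k<2n (trans P≡ p))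
      where
      P≡ : P (coord (index x)) (coord (index y)) (coord (suc k)) ≡ P x y z
      P≡ = P-coord x y z vx vy vz refl refl ez
      decreasing : ∀ j → suc j < 2 * n →
        P (coord (index x)) (coord (index y)) (coord (suc (suc j))) ≡ true →
        P (coord (index x)) (coord (index y)) (coord (suc j)) ≡ true
      decreasing j lt p with index-coord {suc (suc j)} (s≤s z≤n , lt)
                           | index-coord {suc j} (s≤s z≤n , <⇒≤ lt)
      ... | w , vw , ew | u , vu , eu =
        trans (P-coord x y u vx vy vu refl refl eu)
          (down₃ x y u w vx vy vu vw
            (index-cancel-≤ u w vu vw (subst₂ _≤_ (sym eu) (sym ew) (n≤1+n _)))
            (trans (sym (P-coord x y w vx vy vw refl refl ew)) p))

    cubes-array : ∀ x y z → Valid x → Valid y → Valid z → cubes (array P) x y z ≡ P x y z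
    cubes-array x y z vx vy vz = true-antisym
      (to (≤-array x y z vx vy vz) ∘ cubes⁻ (array P) x y z)
      (cubes⁺ (array P) x y z ∘ from (≤-array x y z vx vy vz))

    private
      t : Array
      t = array P

      t≤2n : ∀ i j → t i j ≤ 2 * n
      t≤2n i j = initialRun-≤ _ (2 * n)

    array-mono : ∀ x x' y y' → Valid x → Valid x' → Valid y → Valid y' → x ⊑ x' → y ⊑ y' →
                 t (index x') (index y') ≤ t (index x) (index y)
    array-mono x x' y y' vx vx' vy vy' lx ly = ≤-from-< λ k k< →
      let (z , vz , ez) = index-coord {suc k} (s≤s z≤n , ≤-trans k< (t≤2n (index x') (index y')))
      in subst (_≤ _) ez (from (≤-array x y z vx vy vz)
           (down₁ x x' y z vx vx' vy vz lx (down₂ x' y y' z vx' vy vy' vz ly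
             (to (≤-array x' y' z vx' vy' vz) (subst (_≤ _) (sym ez) k<)))))

    array-symmetric : TotallySymmetric n t
    array-symmetric σ c = mk⇔
      (S⇒Cube (permute σ c) ∘ to S-perm ∘ Cube⇒S c)
      (S⇒Cube c ∘ from S-perm ∘ Cube⇒S (permute σ c))
      where
      -- `Cube` bounds the third coordinate only by the height. Placing all three in the box lets
      -- each be converted to a coordinate and swapped.
      S : ℕ → ℕ → ℕ → Set
      S i j k = InBox (2 * n) i × InBox (2 * n) j × InBox (2 * n) k × (k ≤ t i j)
      swapˡ : ∀ {i j k} → S i j k → S j i k
      swapˡ (bi , bj , bk , le) with index-coord bi | index-coord bj | index-coord bk
      ... | x , vx , refl | y , vy , refl | z , vz , refl = bj , bi , bk ,
        from (≤-array y x z vy vx vz) (trans (swap₁₂ y x z vy vx vz) (to (≤-array x y z vx vy vz) le))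
      swapʳ : ∀ {i j k} → S i j k → S i k j
      swapʳ (bi , bj , bk , le) with index-coord bi | index-coord bj | index-coord bk
      ... | x , vx , refl | y , vy , refl | z , vz , refl = bi , bk , bj ,
        from (≤-array x z y vx vz vy) (trans (swap₂₃ x z y vx vz vy) (to (≤-array x y z vx vy vz) le))
      S-perm : S (c i₀) (c j₀) (c k₀) ⇔ S (c (σ ⟨$⟩ʳ i₀)) (c (σ ⟨$⟩ʳ j₀)) (c (σ ⟨$⟩ʳ k₀))
      S-perm = permutation-invariant S swapˡ swapʳ σ c
      Cube⇒S : ∀ d → Cube n t d → S (d i₀) (d j₀) (d k₀)
      Cube⇒S _ (bi , bj , 1≤k , le) = bi , bj , (1≤k , ≤-trans le (t≤2n _ _)) , le
      S⇒Cube : ∀ d → S (d i₀) (d j₀) (d k₀) → Cube n t d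
      S⇒Cube _ (bi , bj , bk , le) = bi , bj , proj₁ bk , le

    array-complementary : SelfComplementary n t
    array-complementary i j bi bj with index-coord bi | index-coord bj
    ... | x , vx , refl | y , vy , refl
      rewrite index-flip x vx | index-flip y vy = ≤-antisym upper lower
      where
      a b : ℕ
      a = t (index x) (index y)
      b = t (index (flip x)) (index (flip y))
      ≤-array-flip : ∀ z → Valid z → index (flip z) ≤ b ⇔ P (flip x) (flip y) (flip z) ≡ true
      ≤-array-flip z vz = ≤-array (flip x) (flip y) (flip z)
        (flip-valid x vx) (flip-valid y vy) (flip-valid z vz)

      -- The top cube of a nonempty column, at level `a`, is present, so its complement is absent
      -- and `b` stays below the reflected index `2 * n + 1 - a`.
      upper : a + b ≤ 2 * n
      upper with a in ea
      ... | zero = t≤2n (index (flip x)) (index (flip y))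
      ... | suc k with index-coord {suc k} (s≤s z≤n , subst (_≤ 2 * n) ea (t≤2n (index x) (index y)))
      ...   | z , vz , ez = s≤s⁻¹ (subst₂ _<_ (cong (_+ b) ez) (index-sum z vz)
                (+-monoʳ-< (index z) (≰⇒> λ le → contradiction
                  (trans (sym (to (≤-array-flip z vz) le)) (trans (compl x y z vx vy vz)
                    (cong not (to (≤-array x y z vx vy vz) (≤-reflexive (trans ez (sym ea)))))))
                  λ ())))

      -- The cube just above the column, at level `a + 1`, is absent, so its complement is present
      -- and `b` reaches the reflected index `2 * n - a`.
      lower : 2 * n ≤ a + b
      lower with 2 * n ≤? a
      ... | yes p = ≤-trans p (m≤m+n a b)
      ... | no ¬p with index-coord {suc a} (s≤s z≤n , ≰⇒> ¬p)
      ...   | z , vz , ez = s≤s⁻¹ (subst₂ _≤_ (index-sum z vz) (cong (_+ b) ez)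
                (+-monoʳ-≤ (index z) (from (≤-array-flip z vz) (trans (compl x y z vx vy vz)
                  (sym (¬-not λ e → 1+n≰n (subst (_≤ a) ez
                    (from (≤-array x y z vx vy vz) (sym e)))))))))

    array-isTSSCPP : IsTSSCPP n t
    array-isTSSCPP = record
      { planePartition = record
        { bounded = λ i j _ _ → t≤2n i j
        ; rowsDec = rowsDec
        ; colsDec = colsDec
        }
      ; totallySymmetric = array-symmetric
      ; selfComplementary = array-complementary
      }
      where
      rowsDec : ∀ i j j' → InBox (2 * n) i → InBox (2 * n) j → InBox (2 * n) j' →
                j ≤ j' → t i j' ≤ t i j
      rowsDec i j j' bi bj bj' le with index-coord bi | index-coord bj | index-coord bj'
      ... | x , vx , refl | y , vy , refl | y' , vy' , refl =
        array-mono x x y y' vx vx vy vy' ⊑-refl (index-cancel-≤ y y' vy vy' le)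
      colsDec : ∀ i i' j → InBox (2 * n) i → InBox (2 * n) i' → InBox (2 * n) j →
                i ≤ i' → t i' j ≤ t i j
      colsDec i i' j bi bi' bj le with index-coord bi | index-coord bi' | index-coord bj
      ... | x , vx , refl | x' , vx' , refl | y , vy , refl =
        array-mono x x' y y vx vx' vy vy (index-cancel-≤ x x' vx vx' le) ⊑-refl

  -- Diagonal lengths of the slices

  -- `M a d` plays two roles: the length of the `d`-th diagonal of the slice `a`, and the number of
  -- upsets of vertex `a + 1` with the vertices from `d + 1` to `a`.
  record IsTriangle (M : ℕ → ℕ → ℕ) : Set where
    field
      size≤ : ∀ a d → a < n → M a d ≤ a ∸ d
      decr  : ∀ a d → a < n → M a (suc d) ≤ M a d
      step  : ∀ a d → a < n → M a d ≤ suc (M a (suc d))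
      incr  : ∀ a d → suc a < n → M a d ≤ M (suc a) d

    incr-≤ : ∀ k a d → k + a < n → M a d ≤ M (k + a) d
    incr-≤ zero    a d _   = ≤-refl
    incr-≤ (suc k) a d k+a = ≤-trans (incr-≤ k a d (<⇒≤ k+a)) (incr (k + a) d k+a)

  -- The length of the d-th diagonal of the slice Q a.
  triangle : (ℕ → ℕ → ℕ → Bool) → ℕ → ℕ → ℕ
  triangle Q a d = initialRun (λ r → Q a r (r + d)) (a ∸ d)

  module _ {Q} (K : IsKernel Q) where
    open IsKernel K

    anti₂ : ∀ a b b' c c' → a < n → b' < n → c' < n → b ≤ b' → c ≤ c' →
            Q a b' c' ≡ true → Q a b c ≡ true
    anti₂ a b b' c c' va vb' vc' lb lc q =
      anti a b c c' va vb vc' lc (trans (symm a b c' va vb vc')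
        (anti a c' b b' va vc' vb' lb (trans (symm a c' b' va vc' vb') q)))
      where
      vb : b < n
      vb = ≤-<-trans lb vb'

    <-triangle⁻ : ∀ {a r} d → r < triangle Q a d → r + d < a × Q a r (r + d) ≡ true
    <-triangle⁻ {a} {r} d r< = <∸⇒+< r a d (≤-trans r< (initialRun-≤ _ (a ∸ d))) , <-initialRun⁻ _ (a ∸ d) r<

    -- `bound` puts the cell inside the `a` by `a` square, so cutting the diagonal off at length
    -- `a ∸ d` loses nothing.
    <-triangle⁺ : ∀ {a r} d → a < n → r + d < n → Q a r (r + d) ≡ true → r < triangle Q a d
    <-triangle⁺ {a} {r} d va vr q = <-initialRun⁺ _ (a ∸ d) decreasing (m+n≤o⇒m≤o∸n (suc r)
      (bound a r (r + d) va (≤-<-trans (m≤m+n r d) vr) vr q)) q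
      where
      decreasing : ∀ j → suc j < a ∸ d → Q a (suc j) (suc j + d) ≡ true → Q a j (j + d) ≡ true
      decreasing j j< = anti₂ a j (suc j) (j + d) (suc j + d) va
        (≤-<-trans (m≤m+n (suc j) d) lt) lt (n≤1+n j) (n≤1+n (j + d))
        where
        lt : suc j + d < n
        lt = <-trans (<∸⇒+< (suc j) a d j<) va

    triangle-isTriangle : IsTriangle (triangle Q)
    triangle-isTriangle = record
      { size≤ = λ a d _ → initialRun-≤ _ (a ∸ d)
      -- The left neighbour of a cell on diagonal `d + 1` has the same position `r` on diagonal `d`.
      ; decr  = λ a d va → ≤-from-< λ r r< →
          let (lt , q) = <-triangle⁻ (suc d) r<
              le = +-monoʳ-≤ r (n≤1+n d)
          in <-triangle⁺ d va (≤-<-trans le (<-trans lt va))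
               (anti₂ a r r (r + d) (r + suc d) va
                 (≤-<-trans (m≤m+n r (suc d)) (<-trans lt va)) (<-trans lt va) ≤-refl le q)
      -- The cell above position `r + 1` of diagonal `d` is position `r` of diagonal `d + 1`.
      -- Position 0 has no row above it, whence the `suc`.
      ; step  = λ { a d va → ≤-from-< λ
          { zero    _  → s≤s z≤n
          ; (suc r) r< →
              let (lt , q) = <-triangle⁻ d r<
                  lt' = <-trans lt va
              in s≤s (<-triangle⁺ (suc d) va (subst (_< n) (sym (+-suc r d)) lt')
                   (subst (λ c → Q a r c ≡ true) (sym (+-suc r d))
                     (anti₂ a r (suc r) (suc r + d) (suc r + d) va
                       (≤-<-trans (m≤m+n (suc r) d) lt') lt' (n≤1+n r) ≤-refl q))) } }
      ; incr  = λ a d va → ≤-from-< λ r r< →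
          let (lt , q) = <-triangle⁻ d r<
              lt' = <-trans lt (<-trans (n<1+n a) va)
          in <-triangle⁺ d va lt'
               (mono a (suc a) r (r + d) va (≤-<-trans (m≤m+n r d) lt') lt' (n≤1+n a) q)
      }

  triangle-cong : ∀ {Q Q'} → IsKernel Q → IsKernel Q' →
    (∀ a b c → a < n → b < n → c < n → Q a b c ≡ Q' a b c) →
    ∀ a d → a < n → triangle Q a d ≡ triangle Q' a d
  triangle-cong K K' eq a d va =
    ≤-antisym (half K K' eq) (half K' K (λ a b c va vb vc → sym (eq a b c va vb vc)))
    where
    half : ∀ {Q Q'} → IsKernel Q → IsKernel Q' →
      (∀ a b c → a < n → b < n → c < n → Q a b c ≡ Q' a b c) → triangle Q a d ≤ triangle Q' a d
    half K K' eq = ≤-from-< λ r r< →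
      let (lt , q) = <-triangle⁻ K d r<
          lt' = <-trans lt va
      in <-triangle⁺ K' d va lt' (trans (sym (eq a r (r + d) va (≤-<-trans (m≤m+n r d) lt') lt')) q)

  -- A cell with `b ≤ c` has position `b` on diagonal `c - b`, and symmetry covers the other cells.
  triangle-injective : ∀ {Q Q'} → IsKernel Q → IsKernel Q' →
    (∀ a d → a < n → triangle Q a d ≡ triangle Q' a d) →
    ∀ a b c → a < n → b < n → c < n → Q a b c ≡ Q' a b c
  triangle-injective K K' eq a b c va vb vc = true-antisym
    (half K K' eq b c vb vc) (half K' K (λ a d va → sym (eq a d va)) b c vb vc)
    where
    half : ∀ {Q Q'} → IsKernel Q → IsKernel Q' →
      (∀ a d → a < n → triangle Q a d ≡ triangle Q' a d) →
      ∀ b c → b < n → c < n → Q a b c ≡ true → Q' a b c ≡ true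
    half {Q} {Q'} K K' eq b c vb vc q with ≤-total b c
    ... | inj₁ b≤c = sorted b c b≤c vc q
      where
      sorted : ∀ b c → b ≤ c → c < n → Q a b c ≡ true → Q' a b c ≡ true
      sorted b c b≤c vc q with m≤n⇒∃[o]m+o≡n b≤c
      ... | d , refl = proj₂ (<-triangle⁻ K' d (subst (b <_) (eq a d va) (<-triangle⁺ K d va vc q)))
    ... | inj₂ c≤b with m≤n⇒∃[o]m+o≡n c≤b
    ...   | d , refl = trans (IsKernel.symm K' a (c + d) c va vb vc) (proj₂ (<-triangle⁻ K' d
              (subst (c <_) (eq a d va)
                (<-triangle⁺ K d va vb (trans (IsKernel.symm K a c (c + d) va vc vb) q)))))

  -- The kernel with given diagonal lengths

  -- The cell `(b , c)` has position `b ⊓ c` on the diagonal at distance `∣ b - c ∣`, on either side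
  -- of the main one.
  triangleKernel : (ℕ → ℕ → ℕ) → ℕ → ℕ → ℕ → Bool
  triangleKernel M a b c = does (b ⊓ c <? M a ∣ b - c ∣)

  module _ {M} (A : IsTriangle M) where
    open IsTriangle A

    triangleKernel-diagonal : ∀ a r d → triangleKernel M a r (r + d) ≡ does (r <? M a d)
    triangleKernel-diagonal a r d = cong₂ (λ x y → does (x <? M a y))
      (m≤n⇒m⊓n≡m (m≤m+n r d)) (∣m-m+n∣≡n r d)

    triangleKernel⁻ : ∀ a r d → triangleKernel M a r (r + d) ≡ true → r < M a d
    triangleKernel⁻ a r d q = does⁻ (r <? M a d) (trans (sym (triangleKernel-diagonal a r d)) q)

    triangleKernel⁺ : ∀ a r d → r < M a d → triangleKernel M a r (r + d) ≡ true
    triangleKernel⁺ a r d r< = trans (triangleKernel-diagonal a r d) (dec-true (r <? M a d) r<)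

    triangleKernel-comm : ∀ a b c → triangleKernel M a b c ≡ triangleKernel M a c b
    triangleKernel-comm a b c = cong₂ (λ x y → does (x <? M a y)) (⊓-comm b c) (∣-∣-comm b c)

    triangleKernel-isKernel : IsKernel (triangleKernel M)
    triangleKernel-isKernel = record
      { symm  = λ a b c _ _ _ → triangleKernel-comm a b c
      ; anti  = anti
      ; mono  = mono
      ; bound = bound
      }
      where
      -- If `b ≤ c`, the move keeps the position and goes one diagonal inwards, which is `decr`.
      -- Otherwise it goes one position back and one diagonal outwards, which is `step`.
      pred : ∀ a b c → a < n → triangleKernel M a b (suc c) ≡ true → triangleKernel M a b c ≡ true
      pred a b c va q with b ≤? c
      ... | yes b≤c with m≤n⇒∃[o]m+o≡n b≤c
      ...   | d , refl = triangleKernel⁺ a b d (≤-trans (triangleKernel⁻ a b (suc d)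
                (subst (λ x → triangleKernel M a b x ≡ true) (sym (+-suc b d)) q)) (decr a d va))
      pred a b c va q | no b≰c with m≤n⇒∃[o]m+o≡n (≰⇒> b≰c)
      ...   | d , refl = trans (triangleKernel-comm a (suc c + d) c)
                (subst (λ x → triangleKernel M a c x ≡ true) (+-suc c d)
                  (triangleKernel⁺ a c (suc d) (s≤s⁻¹ (≤-trans (triangleKernel⁻ a (suc c) d
                    (trans (triangleKernel-comm a (suc c) (suc c + d)) q)) (step a d va)))))

      anti : ∀ a b c c' → a < n → b < n → c' < n → c ≤ c' →
             triangleKernel M a b c' ≡ true → triangleKernel M a b c ≡ true
      anti a b c c' va vb vc' c≤c' with m≤n⇒∃[o]m+o≡n c≤c'
      ... | k , refl = descend k
        where
        descend : ∀ k → triangleKernel M a b (c + k) ≡ true → triangleKernel M a b c ≡ true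
        descend zero    q = subst (λ x → triangleKernel M a b x ≡ true) (+-identityʳ c) q
        descend (suc k) q = descend k (pred a b (c + k) va
          (subst (λ x → triangleKernel M a b x ≡ true) (+-suc c k) q))

      mono : ∀ a a' b c → a' < n → b < n → c < n → a ≤ a' →
             triangleKernel M a b c ≡ true → triangleKernel M a' b c ≡ true
      mono a a' b c va' _ _ a≤a' q with a' ∸ a | m∸n+n≡m a≤a'
      ... | k | refl = dec-true (b ⊓ c <? M (k + a) ∣ b - c ∣)
              (≤-trans (does⁻ (b ⊓ c <? M a ∣ b - c ∣) q) (incr-≤ k a ∣ b - c ∣ va'))

      bound : ∀ a b c → a < n → b < n → c < n → triangleKernel M a b c ≡ true → c < a
      -- `b ⊓ c + ∣ b - c ∣` is the larger of `b` and `c`, and `size≤` keeps it below `a`.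
      bound a b c va _ _ q = ≤-<-trans c≤ (<∸⇒+< (b ⊓ c) a ∣ b - c ∣
        (≤-trans (does⁻ (b ⊓ c <? M a ∣ b - c ∣) q) (size≤ a ∣ b - c ∣ va)))
        where
        c≤ : c ≤ b ⊓ c + ∣ b - c ∣
        c≤ = subst₂ _≤_ (m⊓n+n∸m≡n b c) (cong (b ⊓ c +_) (∣-∣-comm c b))
               (+-monoʳ-≤ (b ⊓ c) (m∸n≤∣m-n∣ c b))

    triangle-triangleKernel : ∀ a d → a < n → triangle (triangleKernel M) a d ≡ M a d
    triangle-triangleKernel a d va = ≤-antisym
      (≤-from-< λ r r< → triangleKernel⁻ a r d (proj₂ (<-triangle⁻ triangleKernel-isKernel d r<)))
      (≤-from-< λ r r< → <-triangle⁺ triangleKernel-isKernel d va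
        (<-trans (<∸⇒+< r a d (≤-trans r< (size≤ a d va))) va) (triangleKernel⁺ a r d r<))

  -- Tournaments and their upset counts

  -- Row `j ∸ 1` belongs to vertex `j`. Discarding `i` from the vertices from `i` to `j - 1` lowers
  -- the count of upsets exactly when `j` beats `i`.
  tournament : (ℕ → ℕ → ℕ) → Tournament n
  tournament M i j _ _ _ = does (M (j ∸ 1) i <? M (j ∸ 1) (i ∸ 1))

  upsetCounts : Tournament n → ℕ → ℕ → ℕ
  upsetCounts T a d = upsetsIn T (suc a) (suc d) (suc a)

  -- The bounds enter a tournament as proofs, and proofs of `≤` are unique.
  upset≡ : ∀ (T : Tournament n) {i j} p q r → upset T i j ≡ T i j p q r
  upset≡ T {i} {j} p q r with 1 ≤? i | i <? j | j ≤? n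
  ... | yes p' | yes q' | yes r'
    rewrite ≤-irrelevant p' p | ≤-irrelevant q' q | ≤-irrelevant r' r = refl
  ... | no ¬p | _ | _ = contradiction p ¬p
  ... | yes _ | no ¬q | _ = contradiction q ¬q
  ... | yes _ | yes _ | no ¬r = contradiction r ¬r

  upset-cong : ∀ {T T' : Tournament n} → (∀ i j p q r → T i j p q r ≡ T' i j p q r) →
               ∀ i j → upset T i j ≡ upset T' i j
  upset-cong eq i j with 1 ≤? i | i <? j | j ≤? n
  ... | yes p | yes q | yes r = eq i j p q r
  ... | no _  | _     | _     = refl
  ... | yes _ | no _  | _     = refl
  ... | yes _ | yes _ | no _  = refl

  upsetCounts-cong : ∀ {T T' : Tournament n} → (∀ i j p q r → T i j p q r ≡ T' i j p q r) →
                     ∀ a d → upsetCounts T a d ≡ upsetCounts T' a d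
  upsetCounts-cong eq a d =
    cong sum (map-cong (λ w → cong b2n (upset-cong eq w (suc a))) (range (suc d) (suc a)))

  module _ (T : Tournament n) where

    upsetCounts-step : ∀ {a d} → d < a →
      upsetCounts T a d ≡ b2n (upset T (suc d) (suc a)) + upsetCounts T a (suc d)
    upsetCounts-step d<a = sum-range-step _ (s≤s d<a)

    upsetCounts-empty : ∀ {a d} → a ≤ d → upsetCounts T a d ≡ 0
    upsetCounts-empty a≤d = sum-range-empty _ (s≤s a≤d)

    upsetCounts-size : ∀ k a d → a ≤ d + k → upsetCounts T a d ≤ k
    upsetCounts-size zero    a d le = ≤-reflexive (upsetCounts-empty (subst (a ≤_) (+-identityʳ d) le))
    upsetCounts-size (suc k) a d le with d <? a
    ... | yes d<a = subst (_≤ suc k) (sym (upsetCounts-step d<a))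
            (+-mono-≤ (b2n≤1 _) (upsetCounts-size k a (suc d) (subst (a ≤_) (+-suc d k) le)))
    ... | no d≮a = subst (_≤ suc k) (sym (upsetCounts-empty (≮⇒≥ d≮a))) z≤n

    upsetCounts-isTriangle : UpsetCondition n T → IsTriangle (upsetCounts T)
    upsetCounts-isTriangle cond = record
      { size≤ = λ a d _ → upsetCounts-size (a ∸ d) a d (m≤n+m∸n a d)
      ; decr  = decr
      ; step  = step
      ; incr  = incr
      }
      where
      decr : ∀ a d → a < n → upsetCounts T a (suc d) ≤ upsetCounts T a d
      decr a d _ with d <? a
      ... | yes d<a = subst (upsetCounts T a (suc d) ≤_) (sym (upsetCounts-step d<a)) (m≤n+m _ _)
      ... | no d≮a = subst (_≤ upsetCounts T a d)
              (sym (upsetCounts-empty (m≤n⇒m≤1+n (≮⇒≥ d≮a)))) z≤n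

      step : ∀ a d → a < n → upsetCounts T a d ≤ suc (upsetCounts T a (suc d))
      step a d _ with d <? a
      ... | yes d<a = subst (_≤ suc (upsetCounts T a (suc d))) (sym (upsetCounts-step d<a))
              (+-monoˡ-≤ _ (b2n≤1 _))
      ... | no d≮a = subst (_≤ suc (upsetCounts T a (suc d))) (sym (upsetCounts-empty (≮⇒≥ d≮a))) z≤n

      incr : ∀ a d → suc a < n → upsetCounts T a d ≤ upsetCounts T (suc a) d
      incr a d lt with d ≤? a
      -- The upset condition for `u = d + 1` and `v = a + 2`; for larger `d` the smaller vertex has
      -- an empty range.
      ... | yes d≤a = cond (suc d) (suc (suc a)) (s≤s z≤n) (s≤s (s≤s d≤a)) lt _ refl
      ... | no d≰a = subst (_≤ upsetCounts T (suc a) d) (sym (upsetCounts-empty (<⇒≤ (≰⇒> d≰a)))) z≤n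

    -- Consecutive counts differ by the outcome of a single game, so comparing them recovers it.
    tournament-upsetCounts : ∀ i j p q r → tournament (upsetCounts T) i j p q r ≡ T i j p q r
    tournament-upsetCounts (suc d) (suc a) p q r =
      trans (cong (λ x → does (upsetCounts T a (suc d) <? x)) (upsetCounts-step (s<s⁻¹ q)))
        (trans (does-<?-b2n (upsetCounts T a (suc d)) (upset T (suc d) (suc a))) (upset≡ T p q r))

  tournament-cong : ∀ {M M'} → (∀ a d → a < n → M a d ≡ M' a d) →
                    ∀ i j p q r → tournament M i j p q r ≡ tournament M' i j p q r
  tournament-cong eq i (suc a) p q r =
    cong₂ (λ x y → does (x <? y)) (eq a i r) (eq a (i ∸ 1) r)

  module _ {M} (A : IsTriangle M) where
    open IsTriangle A

    -- Backward induction on `d`: both sides vanish for `d ≥ a`, and each game adds back the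
    -- difference of two neighbouring entries, which is 0 or 1.
    upsetCounts-tournament : ∀ a d → a < n → upsetCounts (tournament M) a d ≡ M a d
    upsetCounts-tournament a d va = go (a ∸ d) d (m≤n+m∸n a d)
      where
      beyond : ∀ d → a ≤ d → upsetCounts (tournament M) a d ≡ M a d
      beyond d a≤d = trans (upsetCounts-empty (tournament M) a≤d)
        (sym (n≤0⇒n≡0 (subst (M a d ≤_) (m≤n⇒m∸n≡0 a≤d) (size≤ a d va))))
      go : ∀ k d → a ≤ d + k → upsetCounts (tournament M) a d ≡ M a d
      go zero    d le = beyond d (subst (a ≤_) (+-identityʳ d) le)
      go (suc k) d le with d <? a
      ... | no d≮a  = beyond d (≮⇒≥ d≮a)
      ... | yes d<a = trans (upsetCounts-step (tournament M) d<a)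
        (trans (cong₂ (λ b x → b2n b + x) (upset≡ (tournament M) (s≤s z≤n) (s≤s d<a) va)
                 (go k (suc d) (subst (a ≤_) (+-suc d k) le)))
          (b2n-<?-+ (decr a d va) (step a d va)))

    -- Once the counts are the entries of `M`, the condition is the growth `incr`.
    tournament-upsetCondition : UpsetCondition n (tournament M)
    tournament-upsetCondition (suc d) (suc (suc a)) _ _ v≤n k eq =
      subst₂ _≤_ (sym (upsetCounts-tournament a d (<⇒≤ v≤n)))
        (trans (sym (upsetCounts-tournament (suc a) d v≤n)) eq) (incr a d v≤n)
    tournament-upsetCondition (suc d) (suc zero) _ (s≤s ()) _ _ _

  -- The maps between plane partitions and tournaments

  ideal-cong : ∀ {Q Q'} → (∀ a b c → a < n → b < n → c < n → Q a b c ≡ Q' a b c) →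
    ∀ x y z → Valid x → Valid y → Valid z → ideal Q x y z ≡ ideal Q' x y z
  ideal-cong eq (low a)  (low b)  (low c)  va vb vc = refl
  ideal-cong eq (high a) (low b)  (low c)  va vb vc = cong not (eq a b c va vb vc)
  ideal-cong eq (low b)  (high a) (low c)  vb va vc = cong not (eq a b c va vb vc)
  ideal-cong eq (low b)  (low c)  (high a) vb vc va = cong not (eq a b c va vb vc)
  ideal-cong eq (low a)  (high b) (high c) va vb vc = eq a b c va vb vc
  ideal-cong eq (high b) (low a)  (high c) vb va vc = eq a b c va vb vc
  ideal-cong eq (high b) (high c) (low a)  vb vc va = eq a b c va vb vc
  ideal-cong eq (high a) (high b) (high c) va vb vc = refl

  private
    Q⟨_⟩ : Array → ℕ → ℕ → ℕ → Bool
    Q⟨ t ⟩ = kernel (cubes t)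

    Q-isKernel : ∀ {t} → IsTSSCPP n t → IsKernel Q⟨ t ⟩
    Q-isKernel = kernel-isKernel ∘ cubes-isIdeal

  toTournament : Σ Array (IsTSSCPP n) → Σ (Tournament n) (UpsetCondition n)
  toTournament (t , T) = tournament (triangle Q⟨ t ⟩) ,
    tournament-upsetCondition (triangle-isTriangle (Q-isKernel T))

  toTournament-cong : ∀ {t t'} → _≈PP_ {n} t t' → _≈T_ {n} (toTournament t) (toTournament t')
  toTournament-cong {t , T} {t' , T'} eq = tournament-cong
    (triangle-cong (Q-isKernel T) (Q-isKernel T') λ a b c va vb vc →
      cong (λ h → does (index (high c) ≤? h))
        (eq _ _ (index-inBox (low a) va) (index-inBox (high b) vb)))

  -- Upset counts recover the diagonal lengths, these recover the kernel, and the kernel recovers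
  -- all cubes.
  toTournament-injective : ∀ {t t'} → _≈T_ {n} (toTournament t) (toTournament t') → _≈PP_ {n} t t'
  toTournament-injective {t , T} {t' , T'} eq =
    cubes-injective T T' λ x y z vx vy vz →
      trans (ideal-kernel (cubes-isIdeal T) x y z vx vy vz)
        (trans (ideal-cong Q≡ x y z vx vy vz) (sym (ideal-kernel (cubes-isIdeal T') x y z vx vy vz)))
    where
    Q≡ : ∀ a b c → a < n → b < n → c < n → Q⟨ t ⟩ a b c ≡ Q⟨ t' ⟩ a b c
    Q≡ = triangle-injective (Q-isKernel T) (Q-isKernel T') λ a d va →
      trans (sym (upsetCounts-tournament (triangle-isTriangle (Q-isKernel T)) a d va))
        (trans (upsetCounts-cong eq a d)
          (upsetCounts-tournament (triangle-isTriangle (Q-isKernel T')) a d va))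

  fromTournament : Σ (Tournament n) (UpsetCondition n) → Σ Array (IsTSSCPP n)
  fromTournament (T , cond) = array (ideal (triangleKernel (upsetCounts T))) ,
    array-isTSSCPP (ideal-isIdeal (triangleKernel-isKernel (upsetCounts-isTriangle T cond)))

  -- Three stages cancel in turn: `array` under `cubes`, `triangleKernel` under `triangle`, and
  -- `upsetCounts` under `tournament`.
  toTournament-fromTournament : ∀ T → _≈T_ {n} (toTournament (fromTournament T)) T
  toTournament-fromTournament (T , cond) i j p q r = trans
    (tournament-cong (λ a d va → trans
      (triangle-cong (Q-isKernel (proj₂ (fromTournament (T , cond)))) K
        (λ a b c va vb vc → cubes-array (ideal-isIdeal K) (low a) (high b) (high c) va vb vc) a d va)
      (triangle-triangleKernel A a d va)) i j p q r)
    (tournament-upsetCounts T i j p q r)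
    where
    A = upsetCounts-isTriangle T cond
    K = triangleKernel-isKernel A

theorem16 : (n : ℕ) → 1 ≤ n → Bijection (TSSCPPSetoid n) (TournamentSetoid n)
theorem16 n _ = record
  { to        = toTournament n
  ; cong      = λ {t} {t'} → toTournament-cong n {t} {t'}
  ; bijective = (λ {t} {t'} → toTournament-injective n {t} {t'}) , λ T → fromTournament n T ,
      -- Surjectivity asks for the image of every `t` equivalent to the preimage, so congruence
      -- comes first.
      λ {t} t≈ i j p q r → trans
        (toTournament-cong n {t} {fromTournament n T} t≈ i j p q r)
        (toTournament-fromTournament n T i j p q r)
  }
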